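{- Let $t \ge 0$, let $M_0, M_1, M_2, \ldots$ be linear orders each equal to $\omega$ or $\omega^*$ which alternate, let $m_i$ be non-zero natural numbers, let $\lambda \ge \omega$ be an ordinal and $n_{t+1} \ge 1$ a natural number. Let $A = M_0^{m_0} \cdot M_1^{m_1} \cdots M_{t-1}^{m_{t-1}} \cdot M_t^{\lambda} \cdot M_{t+1}^{m_{t+1}} \cdots$ (a monomial whose terms continue after $M_{t+1}^{m_{t+1}}$) and $B = M_0^{m_0} \cdot M_1^{m_1} \cdots M_{t-1}^{m_{t-1}} \cdot M_t^{\lambda} \cdot M_{t+1}^{n_{t+1}}$. Then $A \equiv_n B$ for all $n$, so $A \equiv B$.
   Context: $\omega^*$ is the reverse of $\omega$. Products are restricted anti-lexicographic products over well-ordered index sets: for linear orders $X_i$ ($i \in I$, $I$ well-ordered) each with a designated element $0$, $\prod_{i\in I} X_i$ is the set of functions $f$ with $f(i) \in X_i$ and $f(i)=0$ for all but finitely many $i$, with $f<g$ iff for some $i$, $f(i)<g(i)$ and $f(j)=g(j)$ for all $j>i$. Factors are listed in increasing order of index (so $X\cdot Y$ is "$Y$ copies of $X$"), and $M^\alpha$ (for an ordinal $\alpha$) stands for $\alpha$ consecutive factors equal to $M$. A monomial is such a product of a non-empty well-ordered sequence of factors. $X \equiv_n Y$ means player II wins the $n$-move Ehrenfeucht–Fraïssé game on $X$ and $Y$; $\equiv$ is elementary equivalence. -}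

module Defs where

open import Data.Nat using (ℕ; zero; suc; _<_; _≤_; _≟_)
open import Data.Fin using (Fin; toℕ)
import Data.Fin as F
open import Data.Bool using (if_then_else_)
open import Data.Product using (Σ; _×_; ∃; _,_)
open import Data.Sum using (_⊎_)
open import Data.Unit using (⊤)
open import Data.Empty using (⊥)
open import Data.List using (List)
open import Data.List.Membership.Propositional using (_∈_)
open import Data.Vec.Functional using (Vector; []; _∷_)
open import Relation.Nullary using (¬_; ⌊_⌋)
open import Relation.Binary.PropositionalEquality using (_≡_; _≢_)
open import Relation.Binary.Structures using (IsStrictTotalOrder)
open import Induction.WellFounded using (WellFounded)
open import Function.Bundles using (_⇔_)

record Str : Set₁ where
  field
    Carrier : Set
    _≈_     : Carrier → Carrier → Set
    _<ₛ_    : Carrier → Carrier → Set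
open Str public

-- Ehrenfeucht–Fraïssé games.  Positions are the k pairs of points
-- chosen so far (a i in X, b i in Y).  Player II wins the n-move game
-- from a position iff after n further rounds (I picks a point in either
-- structure, II answers in the other) the chosen points form a partial
-- isomorphism.

PartIso : (X Y : Str) {k : ℕ} → Vector (Carrier X) k → Vector (Carrier Y) k → Set
PartIso X Y {k} a b =
  (i j : Fin k) → ((_≈_ X (a i) (a j) ⇔ _≈_ Y (b i) (b j))
                 × (_<ₛ_ X (a i) (a j) ⇔ _<ₛ_ Y (b i) (b j)))

IIWins : (X Y : Str) (n : ℕ) {k : ℕ} → Vector (Carrier X) k → Vector (Carrier Y) k → Set
IIWins X Y zero    a b = PartIso X Y a b
IIWins X Y (suc n) a b =
  ((x : Carrier X) → ∃ λ (y : Carrier Y) → IIWins X Y n (x ∷ a) (y ∷ b))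
  × ((y : Carrier Y) → ∃ λ (x : Carrier X) → IIWins X Y n (x ∷ a) (y ∷ b))

_≡[_]_ : Str → ℕ → Str → Set
X ≡[ n ] Y = IIWins X Y n [] []

data Formula : ℕ → Set where
  _≐_ _≺_     : ∀ {k} → Fin k → Fin k → Formula k
  ⊥ᶠ          : ∀ {k} → Formula k
  ¬ᶠ_         : ∀ {k} → Formula k → Formula k
  _∧ᶠ_ _∨ᶠ_ _⇒ᶠ_ : ∀ {k} → Formula k → Formula k → Formula k
  ∀ᶠ ∃ᶠ       : ∀ {k} → Formula (suc k) → Formula k

_⊨_[_] : (X : Str) {k : ℕ} → Formula k → Vector (Carrier X) k → Set
X ⊨ (i ≐ j)  [ ρ ] = _≈_ X (ρ i) (ρ j)
X ⊨ (i ≺ j)  [ ρ ] = _<ₛ_ X (ρ i) (ρ j)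
X ⊨ ⊥ᶠ       [ ρ ] = ⊥
X ⊨ (¬ᶠ φ)   [ ρ ] = ¬ (X ⊨ φ [ ρ ])
X ⊨ (φ ∧ᶠ ψ) [ ρ ] = (X ⊨ φ [ ρ ]) × (X ⊨ ψ [ ρ ])
X ⊨ (φ ∨ᶠ ψ) [ ρ ] = (X ⊨ φ [ ρ ]) ⊎ (X ⊨ ψ [ ρ ])
X ⊨ (φ ⇒ᶠ ψ) [ ρ ] = (X ⊨ φ [ ρ ]) → (X ⊨ ψ [ ρ ])
X ⊨ (∀ᶠ φ)   [ ρ ] = (x : Carrier X) → X ⊨ φ [ x ∷ ρ ]
X ⊨ (∃ᶠ φ)   [ ρ ] = ∃ λ (x : Carrier X) → X ⊨ φ [ x ∷ ρ ]

_≡ᴱ_ : Str → Str → Set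
X ≡ᴱ Y = (φ : Formula 0) → (X ⊨ φ [ [] ]) ⇔ (Y ⊨ φ [ [] ])

record PtOrd : Set₁ where
  field
    Pt   : Set
    _<ₚ_ : Pt → Pt → Set
    𝟘    : Pt
open PtOrd public

record PElt (I : Set) (X : I → PtOrd) : Set where
  field
    fn      : (i : I) → Pt (X i)
    support : List I
    finSupp : (i : I) → fn i ≢ 𝟘 (X i) → i ∈ support
open PElt public

Prod : (I : Set) (_<ᴵ_ : I → I → Set) (X : I → PtOrd) → Str
Prod I _<ᴵ_ X = record
  { Carrier = PElt I X
  ; _≈_     = λ f g → (i : I) → fn f i ≡ fn g i
  ; _<ₛ_    = λ f g → ∃ λ (i : I) → _<ₚ_ (X i) (fn f i) (fn g i)
                        × ((j : I) → i <ᴵ j → fn f j ≡ fn g j)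
  }

data Base : Set where
  ω ω* : Base

⟦_⟧ : Base → PtOrd
⟦ ω  ⟧ = record { Pt = ℕ ; _<ₚ_ = _<_ ; 𝟘 = 0 }
⟦ ω* ⟧ = record { Pt = ℕ ; _<ₚ_ = λ x y → y < x ; 𝟘 = 0 }

record WellOrder : Set₁ where
  field
    Elt    : Set
    _<ʷ_   : Elt → Elt → Set
    isSTO  : IsStrictTotalOrder _≡_ _<ʷ_
    wf     : WellFounded _<ʷ_
open WellOrder public

ω≤ : WellOrder → Set
ω≤ Λ = Σ (ℕ → Elt Λ) λ e → ∀ {a b} → a < b → _<ʷ_ Λ (e a) (e b)

-- Monomials  M_0^{m_0} · … · M_{t-1}^{m_{t-1}} · M_t^Λ · M_{t+1}^{m_{t+1}} ⋯
-- with finitely many (fin L: blocks 0..L-1) or ω many (inf) blocks.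

data Length : Set where
  fin : ℕ → Length
  inf : Length

Block : Length → Set
Block (fin L) = Fin L
Block inf     = ℕ

blk : {L : Length} → Block L → ℕ
blk {fin L} b = toℕ b
blk {inf}   b = b

_≤ᴸ_ : ℕ → Length → Set
k ≤ᴸ fin L = k ≤ L
k ≤ᴸ inf   = ⊤

-- positions inside block j: the exponent of block j as a well-order
-- (Λ for j = t, the finite ordinal m j otherwise)
Pos : (t : ℕ) (m : ℕ → ℕ) (Λ : WellOrder) → ℕ → Set
Pos zero    m Λ zero    = Elt Λ
Pos zero    m Λ (suc j) = Fin (m (suc j))
Pos (suc t) m Λ zero    = Fin (m zero)
Pos (suc t) m Λ (suc j) = Pos t (λ i → m (suc i)) Λ j

PosLt : (t : ℕ) (m : ℕ → ℕ) (Λ : WellOrder) (j : ℕ) → Pos t m Λ j → Pos t m Λ j → Set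
PosLt zero    m Λ zero    = _<ʷ_ Λ
PosLt zero    m Λ (suc j) = F._<_
PosLt (suc t) m Λ zero    = F._<_
PosLt (suc t) m Λ (suc j) = PosLt t (λ i → m (suc i)) Λ j

record Idx (t : ℕ) (m : ℕ → ℕ) (Λ : WellOrder) (L : Length) : Set where
  constructor idx
  field
    block : Block L
    pos   : Pos t m Λ (blk block)
open Idx public

data IdxLt {t m Λ L} : Idx t m Λ L → Idx t m Λ L → Set where
  blk< : ∀ {b b' p p'} → blk b < blk b' → IdxLt (idx b p) (idx b' p')
  pos< : ∀ {b p p'} → PosLt t m Λ (blk b) p p' → IdxLt (idx b p) (idx b p')

Monomial : (M : ℕ → Base) (t : ℕ) (m : ℕ → ℕ) (Λ : WellOrder) (L : Length) → Str
Monomial M t m Λ L = Prod (Idx t m Λ L) IdxLt (λ i → ⟦ M (blk (block i)) ⟧)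

_[_≔_] : (ℕ → ℕ) → ℕ → ℕ → (ℕ → ℕ)
(m [ k ≔ n ]) j = if ⌊ j ≟ k ⌋ then n else m j

{-# OPTIONS --safe #-}

-- Fix e₀ < e₁ < ⋯ in Λ and put d = M_t.  With n moves to go, player II keeps the
-- points aᵢ, bᵢ equal at all coordinates below eₙ, and the parts of the aᵢ at the
-- other coordinates ordered like those of the bᵢ.  Suppose I plays x when n + 1 moves
-- are left.  If x agrees with some aᵢ above eₙ₊₁, II copies bᵢ there.  Otherwise
-- II copies x below eₙ and places y in the right gap: incrementing coordinate eₙ of
-- the neighbour b_p moves it by less than anything visible above eₙ₊₁, in the
-- direction of d; and incrementing a coordinate of block t + 1, whose
-- factor is opposite to d, passes all the bᵢ on the other side.  Nothing about the
-- coordinates above block t matters except that block t + 1 exists.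

module Submission where

open import Defs
open import Data.Empty using (⊥; ⊥-elim)
open import Data.Fin using (Fin; zero; suc; toℕ; fromℕ; fromℕ<)
import Data.Fin.Properties as Finₚ
open import Data.List using (List; []; _∷_; _++_; map; allFin)
open import Data.List.Membership.Propositional using (_∈_)
open import Data.List.Membership.Propositional.Properties using (∈-++⁺ˡ; ∈-++⁺ʳ; ∈-map⁺; ∈-allFin)
open import Data.List.Relation.Unary.Any using (here; there)
open import Data.Nat using (ℕ; zero; suc; _<_; _≤_; _≟_; _<?_; z≤n; s≤s; z<s; _⊔_)
open import Data.Nat.Properties
  using (<-cmp; <-irrefl; <-trans; <-≤-trans; ≤-trans; <⇒≤; ≮⇒≥; n<1+n; <⇒≢; ≤-refl; ≤-pred;
         m⊔n≤o⇒m≤o; m⊔n≤o⇒n≤o)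
  renaming (<-isStrictTotalOrder to ℕ-<-isStrictTotalOrder)
open import Data.Product using (Σ; _×_; ∃; _,_; proj₁; proj₂)
open import Data.Sum using (_⊎_; inj₁; inj₂)
open import Data.Unit using (tt)
import Data.Vec.Functional as V
open import Function using (_∘_; id; flip; const)
open import Function.Bundles using (_⇔_; mk⇔; Equivalence)
open import Function.Construct.Composition using (_⇔-∘_)
open import Function.Construct.Symmetry using (⇔-sym)
import Relation.Binary.Construct.Flip.EqAndOrd as Flip
open import Relation.Binary.Definitions using (Tri; tri<; tri≈; tri>; Trichotomous; Transitive)
open import Relation.Binary.PropositionalEquality
  using (_≡_; _≢_; refl; sym; trans; cong; subst; subst₂; subst-subst; isEquivalence)
open import Relation.Binary.Structures using (IsStrictTotalOrder)
open import Relation.Binary.Structures.Biased using (isStrictTotalOrderᶜ)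
open import Relation.Nullary using (¬_; Dec; yes; no; _×-dec_; ¬?)
open import Relation.Nullary.Decidable using (decidable-stable)

-- Ehrenfeucht–Fraïssé games and elementary equivalence

-- Later moves never change earlier pairs, so remaining moves may be wasted: I replays the point
-- `a i`, and the old pairs reappear shifted by one.
IIWins⇒PartIso : ∀ {X Y} n {k} {a : V.Vector (Carrier X) k} {b : V.Vector (Carrier Y) k} →
  IIWins X Y n a b → PartIso X Y a b
IIWins⇒PartIso zero    w = w
IIWins⇒PartIso (suc n) {a = a} w i j =
  IIWins⇒PartIso n (proj₂ (proj₁ w (a i))) (suc i) (suc j)

rank : ∀ {k} → Formula k → ℕ
rank (_ ≐ _)  = 0
rank (_ ≺ _)  = 0
rank ⊥ᶠ       = 0
rank (¬ᶠ φ)   = rank φ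
rank (φ ∧ᶠ ψ) = rank φ ⊔ rank ψ
rank (φ ∨ᶠ ψ) = rank φ ⊔ rank ψ
rank (φ ⇒ᶠ ψ) = rank φ ⊔ rank ψ
rank (∀ᶠ φ)   = suc (rank φ)
rank (∃ᶠ φ)   = suc (rank φ)

module _ {X Y : Str} where
  open Equivalence

  -- Induction on the formula, the remaining moves bounding its quantifier rank. Each quantifier
  -- spends one move. Both directions are proved together so that negation and implication go
  -- through.
  IIWins⇒⊨⇔ : ∀ {k} (φ : Formula k) n → rank φ ≤ n →
    {a : V.Vector (Carrier X) k} {b : V.Vector (Carrier Y) k} →
    IIWins X Y n a b → (X ⊨ φ [ a ]) ⇔ (Y ⊨ φ [ b ])
  IIWins⇒⊨⇔ (i ≐ j) n _ w = proj₁ (IIWins⇒PartIso n w i j)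
  IIWins⇒⊨⇔ (i ≺ j) n _ w = proj₂ (IIWins⇒PartIso n w i j)
  IIWins⇒⊨⇔ ⊥ᶠ      n _ w = mk⇔ id id
  IIWins⇒⊨⇔ (¬ᶠ φ)  n r w = mk⇔ (_∘ from φ⇔) (_∘ to φ⇔)
    where φ⇔ = IIWins⇒⊨⇔ φ n r w
  IIWins⇒⊨⇔ (φ ∧ᶠ ψ) n r w =
    mk⇔ (λ (p , q) → to φ⇔ p , to ψ⇔ q) (λ (p , q) → from φ⇔ p , from ψ⇔ q)
    where φ⇔ = IIWins⇒⊨⇔ φ n (m⊔n≤o⇒m≤o _ _ r) w
          ψ⇔ = IIWins⇒⊨⇔ ψ n (m⊔n≤o⇒n≤o (rank φ) _ r) w
  IIWins⇒⊨⇔ (φ ∨ᶠ ψ) n r w =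
    mk⇔ (λ { (inj₁ p) → inj₁ (to φ⇔ p)   ; (inj₂ q) → inj₂ (to ψ⇔ q) })
        (λ { (inj₁ p) → inj₁ (from φ⇔ p) ; (inj₂ q) → inj₂ (from ψ⇔ q) })
    where φ⇔ = IIWins⇒⊨⇔ φ n (m⊔n≤o⇒m≤o _ _ r) w
          ψ⇔ = IIWins⇒⊨⇔ ψ n (m⊔n≤o⇒n≤o (rank φ) _ r) w
  IIWins⇒⊨⇔ (φ ⇒ᶠ ψ) n r w =
    mk⇔ (λ f → to ψ⇔ ∘ f ∘ from φ⇔) (λ f → from ψ⇔ ∘ f ∘ to φ⇔)
    where φ⇔ = IIWins⇒⊨⇔ φ n (m⊔n≤o⇒m≤o _ _ r) w
          ψ⇔ = IIWins⇒⊨⇔ ψ n (m⊔n≤o⇒n≤o (rank φ) _ r) w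
  IIWins⇒⊨⇔ (∀ᶠ φ) (suc n) (s≤s r) (forth , back) =
    mk⇔ (λ h y → let x , w = back y  in to   (IIWins⇒⊨⇔ φ n r w) (h x))
        (λ h x → let y , w = forth x in from (IIWins⇒⊨⇔ φ n r w) (h y))
  IIWins⇒⊨⇔ (∃ᶠ φ) (suc n) (s≤s r) (forth , back) =
    mk⇔ (λ (x , p) → let y , w = forth x in y , to   (IIWins⇒⊨⇔ φ n r w) p)
        (λ (y , p) → let x , w = back y  in x , from (IIWins⇒⊨⇔ φ n r w) p)

  ≡[]⇒≡ᴱ : (∀ k → X ≡[ k ] Y) → X ≡ᴱ Y
  ≡[]⇒≡ᴱ w φ = IIWins⇒⊨⇔ φ (rank φ) ≤-refl (w (rank φ))

-- Strict total orders

-- This finite search finds the leading coordinate where two elements differ, and extremal points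
-- among those already played. Maximality is stated negatively, so ties under `key` are harmless.
greatest : {A B : Set} {_≈_ _≺_ : B → B → Set} → IsStrictTotalOrder _≈_ _≺_ →
  (key : A → B) {Q : A → Set} (Q? : ∀ a → Dec (Q a)) (l : List A) →
  (∀ {a} → a ∈ l → ¬ Q a) ⊎ (∃ λ m → Q m × (∀ {a} → a ∈ l → Q a → ¬ (key m ≺ key a)))
greatest sto key Q? [] = inj₁ λ ()
greatest sto key Q? (x ∷ l) with Q? x | greatest sto key Q? l
... | no ¬q | inj₁ none = inj₁ λ { (here refl) → ¬q ; (there a∈l) → none a∈l }
... | no ¬q | inj₂ (m , qm , max) =
      inj₂ (m , qm , λ { (here refl) q → ⊥-elim (¬q q) ; (there a∈l) → max a∈l })
... | yes q | inj₁ none =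
      inj₂ (x , q , λ { (here refl) _ → irrefl Eq.refl
                      ; (there a∈l) qa → ⊥-elim (none a∈l qa) })
  where open IsStrictTotalOrder sto using (irrefl; module Eq)
... | yes q | inj₂ (m , qm , max) with IsStrictTotalOrder.compare sto (key m) (key x)
...   | tri< m<x _ _ =
        inj₂ (x , q , λ { (here refl) _ → irrefl Eq.refl
                        ; (there a∈l) qa x<a → max a∈l qa (≺-trans m<x x<a) })
  where open IsStrictTotalOrder sto using (irrefl; module Eq) renaming (trans to ≺-trans)
...   | tri≈ m≮x _ _ = inj₂ (m , qm , λ { (here refl) _ → m≮x ; (there a∈l) → max a∈l })
...   | tri> m≮x _ _ = inj₂ (m , qm , λ { (here refl) _ → m≮x ; (there a∈l) → max a∈l })

-- Reversing relations for `ω*` lets one strategy, written for a direction `d`, serve both possible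
-- values of `d`.
orient : Base → {A : Set} → (A → A → Set) → (A → A → Set)
orient ω  R = R
orient ω* R = flip R

orient-map : ∀ d {A : Set} {R S : A → A → Set} → (∀ {x y} → R x y → S x y) →
  ∀ {x y} → orient d R x y → orient d S x y
orient-map ω  f = f
orient-map ω* f = f

orient-sto : ∀ d {A : Set} {_≈_ _≺_ : A → A → Set} →
  IsStrictTotalOrder _≈_ _≺_ → IsStrictTotalOrder _≈_ (orient d _≺_)
orient-sto ω  sto = sto
orient-sto ω* sto = Flip.isStrictTotalOrder sto

orient-opposite : ∀ {s d} → s ≢ d → {A : Set} {R : A → A → Set} {x y : A} →
  orient s R x y → orient d R y x
orient-opposite {ω}  {ω}  s≢d = ⊥-elim (s≢d refl)
orient-opposite {ω}  {ω*} s≢d = id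
orient-opposite {ω*} {ω}  s≢d = id
orient-opposite {ω*} {ω*} s≢d = ⊥-elim (s≢d refl)

-- The inner orientation is the order of the factor, the outer one the direction of the move; for
-- `ω*` the two reversals cancel.
orient-suc : ∀ s {n} → orient s (orient s _<_) n (suc n)
orient-suc ω  = n<1+n _
orient-suc ω* = n<1+n _

-- Coordinates as natural numbers

-- `Pt ⟦ b ⟧` reduces to `ℕ` only after a split on `b`; through this map coordinates of all factors
-- are handled uniformly.
value : ∀ b → Pt ⟦ b ⟧ → ℕ
value ω  = id
value ω* = id

point : ∀ b → ℕ → Pt ⟦ b ⟧
point ω  = id
point ω* = id

value-point : ∀ b v → value b (point b v) ≡ v
value-point ω  v = refl
value-point ω* v = refl

value-injective : ∀ b {p q} → value b p ≡ value b q → p ≡ q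
value-injective ω  = id
value-injective ω* = id

value-𝟘 : ∀ b → value b (𝟘 ⟦ b ⟧) ≡ 0
value-𝟘 ω  = refl
value-𝟘 ω* = refl

<ₚ⇔value< : ∀ b {p q} → _<ₚ_ ⟦ b ⟧ p q ⇔ orient b _<_ (value b p) (value b q)
<ₚ⇔value< ω  = mk⇔ id id
<ₚ⇔value< ω* = mk⇔ id id

-- Comparison of product elements at an upper set of coordinates

module Product {I : Set} {_<ᴵ_ : I → I → Set} (sto : IsStrictTotalOrder _≡_ _<ᴵ_)
               (σ : I → Base) where

  open IsStrictTotalOrder sto public
    using () renaming (compare to <ᴵ-compare; trans to <ᴵ-trans; irrefl to <ᴵ-irrefl; _≟_ to _≟ᴵ_)

  Elem : Set
  Elem = PElt I (λ i → ⟦ σ i ⟧)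

  val : Elem → I → ℕ
  val f i = value (σ i) (fn f i)

  val-support : ∀ f {i} → val f i ≢ 0 → i ∈ support f
  val-support f {i} vi≢0 = finSupp f i λ fi≡0 → vi≢0 (trans (cong (value (σ i)) fi≡0) (value-𝟘 (σ i)))

  fromVal : (v : I → ℕ) (l : List I) → (∀ {i} → v i ≢ 0 → i ∈ l) → Elem
  fromVal v l h = record
    { fn = λ i → point (σ i) (v i)
    ; support = l
    ; finSupp = λ i pi≢0 → h λ vi≡0 → pi≢0 (value-injective (σ i)
        (trans (value-point (σ i) (v i)) (trans vi≡0 (sym (value-𝟘 (σ i))))))
    }

  val-fromVal : ∀ v l (h : ∀ {i} → v i ≢ 0 → i ∈ l) i → val (fromVal v l h) i ≡ v i
  val-fromVal v l h i = value-point (σ i) (v i)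

  -- A record rather than a bare function type, so that `H`, `f` and `g` can be inferred from
  -- proofs.
  record Agree (H : I → Set) (f g : Elem) : Set where
    constructor agree
    field agrees : ∀ i → H i → val f i ≡ val g i
  open Agree public

  -- For upward closed `H` this is the anti-lexicographic order of the restrictions to `H`: all
  -- indices above the deciding one then lie in `H` too.
  record Less (H : I → Set) (f g : Elem) : Set where
    constructor less
    field
      index : I
      high  : H index
      here< : orient (σ index) _<_ (val f index) (val g index)
      above : ∀ j → index <ᴵ j → val f j ≡ val g j

  Less-mono : ∀ {H K : I → Set} → (∀ {i} → H i → K i) → ∀ {f g} → Less H f g → Less K f g
  Less-mono H⊆K (less i Hi f<g f≡g) = less i (H⊆K Hi) f<g f≡g

  private module Coord i = IsStrictTotalOrder (orient-sto (σ i) ℕ-<-isStrictTotalOrder)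

  -- The higher of the two deciding indices decides the composite.
  Less-trans : ∀ {H} → Transitive (Less H)
  Less-trans (less i Hi f<g f≡g) (less j Hj g<h g≡h) with <ᴵ-compare i j
  ... | tri< i<j _ _ = less j Hj (subst (λ v → orient (σ j) _<_ v _) (sym (f≡g j i<j)) g<h)
                       λ l j<l → trans (f≡g l (<ᴵ-trans i<j j<l)) (g≡h l j<l)
  ... | tri≈ _ refl _ = less i Hi (Coord.trans i f<g g<h)
                        λ l i<l → trans (f≡g l i<l) (g≡h l i<l)
  ... | tri> _ _ j<i = less i Hi (subst (orient (σ i) _<_ _) (g≡h i j<i) f<g)
                       λ l i<l → trans (f≡g l i<l) (g≡h l (<ᴵ-trans j<i i<l))

  Less⇒¬Agree : ∀ {H f g} → Less H f g → ¬ Agree H f g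
  Less⇒¬Agree (less i Hi f<g _) f≈g = Coord.irrefl i (agrees f≈g i Hi) f<g

  Agree-refl : ∀ {H f} → Agree H f f
  Agree-refl = agree λ _ _ → refl

  Agree-sym : ∀ {H f g} → Agree H f g → Agree H g f
  Agree-sym f≈g = agree λ i Hi → sym (agrees f≈g i Hi)

  Agree-trans : ∀ {H f g h} → Agree H f g → Agree H g h → Agree H f h
  Agree-trans f≈g g≈h = agree λ i Hi → trans (agrees f≈g i Hi) (agrees g≈h i Hi)

  module _ {H : I → Set} (H? : ∀ i → Dec (H i)) (H-up : ∀ {i j} → i <ᴵ j → H i → H j) where

    private
      Less-irrefl : ∀ {f} → ¬ Less H f f
      Less-irrefl f<f = Less⇒¬Agree f<f Agree-refl

      tri-less : ∀ {f g} → Less H f g → Tri (Less H f g) (Agree H f g) (Less H g f)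
      tri-less f<g = tri< f<g (Less⇒¬Agree f<g) (λ g<f → Less-irrefl (Less-trans f<g g<f))

      tri-greater : ∀ {f g} → Less H g f → Tri (Less H f g) (Agree H f g) (Less H g f)
      tri-greater g<f = tri> (λ f<g → Less-irrefl (Less-trans f<g g<f))
                             (Less⇒¬Agree g<f ∘ Agree-sym) g<f

      differ⇒∈support : ∀ f g {i} → val f i ≢ val g i → i ∈ support f ++ support g
      differ⇒∈support f g {i} f≢g with val f i ≟ 0
      ... | no fi≢0  = ∈-++⁺ˡ (val-support f fi≢0)
      ... | yes fi≡0 =
        ∈-++⁺ʳ (support f) (val-support g λ gi≡0 → f≢g (trans fi≡0 (sym gi≡0)))

    -- Any difference lies in one of the two finite supports, so a search either finds the highest
    -- difference within `H`, which decides, or shows agreement on `H`.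
    Less-compare : Trichotomous (Agree H) (Less H)
    Less-compare f g
      with greatest sto id (λ i → H? i ×-dec ¬? (val f i ≟ val g i)) (support f ++ support g)
    ... | inj₁ none = tri≈ (λ f<g → Less⇒¬Agree f<g f≈g) f≈g
                           (λ g<f → Less⇒¬Agree g<f (Agree-sym f≈g))
      where
      f≈g : Agree H f g
      f≈g = agree λ i Hi → decidable-stable (val f i ≟ val g i)
        λ f≢g → none (differ⇒∈support f g f≢g) (Hi , f≢g)
    ... | inj₂ (i , (Hi , f≢g) , max) with Coord.compare i (val f i) (val g i)
    ...   | tri< f<g _ _ = tri-less (less i Hi f<g λ j i<j → decidable-stable (val f j ≟ val g j)
              λ fj≢gj → max (differ⇒∈support f g fj≢gj) (H-up i<j Hi , fj≢gj) i<j)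
    ...   | tri≈ _ f≡g _ = ⊥-elim (f≢g f≡g)
    ...   | tri> _ _ g<f = tri-greater (less i Hi g<f λ j i<j → sym (decidable-stable (val f j ≟ val g j)
              λ fj≢gj → max (differ⇒∈support f g fj≢gj) (H-up i<j Hi , fj≢gj) i<j))

    Less-isStrictTotalOrder : IsStrictTotalOrder (Agree H) (Less H)
    Less-isStrictTotalOrder = isStrictTotalOrderᶜ record
      { isEquivalence = record { refl = Agree-refl ; sym = Agree-sym ; trans = Agree-trans }
      ; trans   = Less-trans
      ; compare = Less-compare
      }

  -- Incrementing one coordinate

  bump : I → Elem → Elem
  bump i f = fromVal v (i ∷ support f) v≢0⇒∈
    module Bump where
    v : I → ℕ
    v j with j ≟ᴵ i
    ... | yes _ = suc (val f j)
    ... | no  _ = val f j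
    v≢0⇒∈ : ∀ {j} → v j ≢ 0 → j ∈ i ∷ support f
    v≢0⇒∈ {j} vj≢0 with j ≟ᴵ i
    ... | yes refl = here refl
    ... | no  _    = there (val-support f vj≢0)

  val-bump-≡ : ∀ i f → val (bump i f) i ≡ suc (val f i)
  val-bump-≡ i f = trans (val-fromVal (Bump.v i f) _ (λ {j} → Bump.v≢0⇒∈ i f {j}) i) v≡
    where
    v≡ : Bump.v i f i ≡ suc (val f i)
    v≡ with i ≟ᴵ i
    ... | yes _  = refl
    ... | no i≢i = ⊥-elim (i≢i refl)

  val-bump-≢ : ∀ i f {j} → j ≢ i → val (bump i f) j ≡ val f j
  val-bump-≢ i f {j} j≢i = trans (val-fromVal (Bump.v i f) _ (λ {j} → Bump.v≢0⇒∈ i f {j}) j) v≡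
    where
    v≡ : Bump.v i f j ≡ val f j
    v≡ with j ≟ᴵ i
    ... | yes j≡i = ⊥-elim (j≢i j≡i)
    ... | no _    = refl

  Agree-bump : ∀ {H} i f → ¬ H i → Agree H (bump i f) f
  Agree-bump i f ¬Hi = agree λ j Hj → val-bump-≢ i f λ { refl → ¬Hi Hj }

  -- Only coordinate `i` changes, so it decides. The factor is passed as a variable `s` with an
  -- equation because `σ i` cannot be split on.
  Less-bump : ∀ {H} i f s → σ i ≡ s → H i → orient s (Less H) f (bump i f)
  Less-bump i f s σi≡s Hi with orient-suc s {val f i}
  Less-bump i f ω  σi≡s Hi | step = less i Hi
    (subst₂ (λ r v → orient r _<_ (val f i) v) (sym σi≡s) (sym (val-bump-≡ i f)) step)
    λ j i<j → sym (val-bump-≢ i f λ { refl → <ᴵ-irrefl refl i<j })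
  Less-bump i f ω* σi≡s Hi | step = less i Hi
    (subst₂ (λ r v → orient r _<_ v (val f i)) (sym σi≡s) (sym (val-bump-≡ i f)) step)
    λ j i<j → val-bump-≢ i f λ { refl → <ᴵ-irrefl refl i<j }

-- Configurations of pairs of points

-- The common outcome of two comparisons, kept with its witnesses. For strict total orders it yields
-- both equivalences demanded of a partial isomorphism.
data Alike (X Y : Str) (x x′ : Carrier X) (y y′ : Carrier Y) : Set where
  both< : _<ₛ_ X x x′ → _<ₛ_ Y y y′ → Alike X Y x x′ y y′
  both≈ : _≈_ X x x′  → _≈_ Y y y′  → Alike X Y x x′ y y′
  both> : _<ₛ_ X x′ x → _<ₛ_ Y y′ y → Alike X Y x x′ y y′

Alike-swap : ∀ {X Y x x′ y y′} → Alike X Y x x′ y y′ → Alike Y X y y′ x x′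
Alike-swap (both< p q) = both< q p
Alike-swap (both≈ p q) = both≈ q p
Alike-swap (both> p q) = both> q p

oriented : Base → Str → Str
oriented d X = record { Carrier = Carrier X ; _≈_ = _≈_ X ; _<ₛ_ = orient d (_<ₛ_ X) }

Alike-orient : ∀ d {X Y x x′ y y′} →
  Alike X Y x x′ y y′ → Alike (oriented d X) (oriented d Y) x x′ y y′
Alike-orient ω  (both< p q) = both< p q
Alike-orient ω  (both≈ p q) = both≈ p q
Alike-orient ω  (both> p q) = both> p q
Alike-orient ω* (both< p q) = both> p q
Alike-orient ω* (both≈ p q) = both≈ p q
Alike-orient ω* (both> p q) = both< p q

Alike-unorient : ∀ d {X Y x x′ y y′} →
  Alike (oriented d X) (oriented d Y) x x′ y y′ → Alike X Y x x′ y y′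
Alike-unorient ω  (both< p q) = both< p q
Alike-unorient ω  (both≈ p q) = both≈ p q
Alike-unorient ω  (both> p q) = both> p q
Alike-unorient ω* (both< p q) = both> p q
Alike-unorient ω* (both≈ p q) = both≈ p q
Alike-unorient ω* (both> p q) = both< p q

IsOrder : Str → Set
IsOrder X = IsStrictTotalOrder (_≈_ X) (_<ₛ_ X)

module _ {X Y : Str} (stoˣ : IsOrder X) (stoʸ : IsOrder Y) where

  private
    module X = IsStrictTotalOrder stoˣ
    module Y = IsStrictTotalOrder stoʸ

  Alike-flip : ∀ {x x′ y y′} → Alike X Y x x′ y y′ → Alike X Y x′ x y′ y
  Alike-flip (both< p q) = both> p q
  Alike-flip (both≈ p q) = both≈ (X.Eq.sym p) (Y.Eq.sym q)
  Alike-flip (both> p q) = both< p q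

  Alike-respˡ : ∀ {x x′ x″ y y′ y″} → _≈_ X x x″ → _≈_ Y y y″ →
    Alike X Y x x′ y y′ → Alike X Y x″ x′ y″ y′
  Alike-respˡ x≈ y≈ (both< p q) = both< (X.<-respˡ-≈ x≈ p) (Y.<-respˡ-≈ y≈ q)
  Alike-respˡ x≈ y≈ (both≈ p q) =
    both≈ (X.Eq.trans (X.Eq.sym x≈) p) (Y.Eq.trans (Y.Eq.sym y≈) q)
  Alike-respˡ x≈ y≈ (both> p q) = both> (X.<-respʳ-≈ x≈ p) (Y.<-respʳ-≈ y≈ q)

  Alike⇒≈⇔ : ∀ {x x′ y y′} → Alike X Y x x′ y y′ → _≈_ X x x′ ⇔ _≈_ Y y y′
  Alike⇒≈⇔ (both< p q) = mk⇔ (λ e → ⊥-elim (X.irrefl e p)) (λ e → ⊥-elim (Y.irrefl e q))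
  Alike⇒≈⇔ (both≈ p q) = mk⇔ (const q) (const p)
  Alike⇒≈⇔ (both> p q) = mk⇔ (λ e → ⊥-elim (X.irrefl (X.Eq.sym e) p))
                             (λ e → ⊥-elim (Y.irrefl (Y.Eq.sym e) q))

  Alike⇒<⇔ : ∀ {x x′ y y′} → Alike X Y x x′ y y′ → _<ₛ_ X x x′ ⇔ _<ₛ_ Y y y′
  Alike⇒<⇔ (both< p q) = mk⇔ (const q) (const p)
  Alike⇒<⇔ (both≈ p q) = mk⇔ (λ l → ⊥-elim (X.irrefl p l)) (λ l → ⊥-elim (Y.irrefl q l))
  Alike⇒<⇔ (both> p q) = mk⇔ (λ l → ⊥-elim (X.asym l p)) (λ l → ⊥-elim (Y.asym l q))

  Alike⇒< : ∀ {x x′ y y′} → Alike X Y x x′ y y′ → _<ₛ_ X x x′ → _<ₛ_ Y y y′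
  Alike⇒< = Equivalence.to ∘ Alike⇒<⇔

-- The strategy of player II

module Game {C : Set} {_<ᶜ_ : C → C → Set} (stoᶜ : IsStrictTotalOrder _≡_ _<ᶜ_)
            (sign : C → Base) (d : Base)
            (e : ℕ → C) (e-mono : ∀ n → e n <ᶜ e (suc n)) (e-sign : ∀ n → sign (e n) ≡ d) where

  private module C = IsStrictTotalOrder stoᶜ

  -- Low 0 is empty so that at the end of the game all coordinates count.
  Low : ℕ → C → Set
  Low zero    c = ⊥
  Low (suc n) c = c <ᶜ e (suc n)

  low? : ∀ n c → Dec (Low n c)
  low? zero    c = no id
  low? (suc n) c = c C.<? e (suc n)

  Low-down : ∀ n {c c′} → c <ᶜ c′ → Low n c′ → Low n c
  Low-down (suc n) = C.trans

  Low⇒<e : ∀ n {c} → Low n c → c <ᶜ e n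
  Low⇒<e (suc n) l = l

  Low-suc : ∀ n {c} → Low n c → Low (suc n) c
  Low-suc n l = C.trans (Low⇒<e n l) (e-mono n)

  -- The index set contains `C` as an initial segment, by `split`, and has an index above it whose
  -- factor runs against `d`. This is all that the strategy uses of a monomial.
  record Extension : Set₁ where
    field
      Ix        : Set
      _<ᴵ_      : Ix → Ix → Set
      isSTOᴵ    : IsStrictTotalOrder _≡_ _<ᴵ_
      σ         : Ix → Base
      ι         : C → Ix
      ι-mono    : ∀ {c c′} → c <ᶜ c′ → ι c <ᴵ ι c′
      ι-sign    : ∀ c → σ (ι c) ≡ sign c
      split     : ∀ i → (∃ λ c → i ≡ ι c) ⊎ (∀ c → ι c <ᴵ i)
      top       : Ix
      top-above : ∀ c → ι c <ᴵ top
      top-sign  : σ top ≢ d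

    open Product isSTOᴵ σ public

    structure : Str
    structure = Prod Ix _<ᴵ_ (λ i → ⟦ σ i ⟧)

    ι-reflect : ∀ {c c′} → ι c <ᴵ ι c′ → c <ᶜ c′
    ι-reflect {c} {c′} lt with C.compare c c′
    ... | tri< c<c′ _ _ = c<c′
    ... | tri≈ _ refl _ = ⊥-elim (<ᴵ-irrefl refl lt)
    ... | tri> _ _ c′<c = ⊥-elim (<ᴵ-irrefl refl (<ᴵ-trans lt (ι-mono c′<c)))

    ι-injective : ∀ {c c′} → ι c ≡ ι c′ → c ≡ c′
    ι-injective {c} {c′} eq with C.compare c c′
    ... | tri< c<c′ _ _ = ⊥-elim (<ᴵ-irrefl eq (ι-mono c<c′))
    ... | tri≈ _ c≡c′ _ = c≡c′
    ... | tri> _ _ c′<c = ⊥-elim (<ᴵ-irrefl (sym eq) (ι-mono c′<c))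

    -- The complement of the image of `Low n`, by `low-or-high` and `¬High-low`, phrased so that
    -- upward closure is immediate. It grows as `n` decreases, making `Level n` finer.
    High : ℕ → Ix → Set
    High n i = ∀ c → Low n c → ι c <ᴵ i

    High-suc : ∀ n {i} → High (suc n) i → High n i
    High-suc n h c l = h c (Low-suc n l)

    High-up : ∀ n {i j} → i <ᴵ j → High n i → High n j
    High-up n i<j h c l = <ᴵ-trans (h c l) i<j

    High-e : ∀ n → High n (ι (e n))
    High-e n c l = ι-mono (Low⇒<e n l)

    ¬High-low : ∀ n {c} → Low n c → ¬ High n (ι c)
    ¬High-low n l h = <ᴵ-irrefl refl (h _ l)

    low-or-high : ∀ n i → (∃ λ c → Low n c × i ≡ ι c) ⊎ High n i
    low-or-high n i with split i
    ... | inj₂ above = inj₂ λ c _ → above c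
    ... | inj₁ (c , refl) with low? n c
    ...   | yes l = inj₁ (c , l , refl)
    ...   | no ¬l = inj₂ λ c′ l′ → high c′ l′ (C.compare c′ c)
      where
      high : ∀ c′ → Low n c′ → Tri (c′ <ᶜ c) (c′ ≡ c) (c <ᶜ c′) → ι c′ <ᴵ ι c
      high c′ l′ (tri< c′<c _ _) = ι-mono c′<c
      high c′ l′ (tri≈ _ refl _) = ⊥-elim (¬l l′)
      high c′ l′ (tri> _ _ c<c′) = ⊥-elim (¬l (Low-down n c<c′ l′))

    high? : ∀ n i → Dec (High n i)
    high? n i with low-or-high n i
    ... | inj₁ (c , l , refl) = no (¬High-low n l)
    ... | inj₂ h              = yes h

    Level : ℕ → Str
    Level n = record { Carrier = Elem ; _≈_ = Agree (High n) ; _<ₛ_ = Less (High n) }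

    Level-isOrder : ∀ n → IsOrder (Level n)
    Level-isOrder n = Less-isStrictTotalOrder (high? n) (High-up n)

    oriented-isOrder : ∀ n → IsOrder (oriented d (Level n))
    oriented-isOrder n = orient-sto d (Level-isOrder n)

    Less-coarse : ∀ n {f g} → Less (High (suc n)) f g → Less (High n) f g
    Less-coarse n = Less-mono (High-suc n)

    Agree⇔≈ : ∀ {f g} → _≈_ structure f g ⇔ Agree (High 0) f g
    Agree⇔≈ = mk⇔ (λ f≈g → agree λ i _ → cong (value (σ i)) (f≈g i))
                  (λ f≈g i → value-injective (σ i) (agrees f≈g i λ _ ()))

    Less⇔< : ∀ {f g} → _<ₛ_ structure f g ⇔ Less (High 0) f g
    Less⇔< = mk⇔
      (λ (i , f<g , f≡g) → less i (λ _ ()) (Equivalence.to (<ₚ⇔value< (σ i)) f<g)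
        λ j i<j → cong (value (σ j)) (f≡g j i<j))
      (λ (less i _ f<g f≡g) → i , Equivalence.from (<ₚ⇔value< (σ i)) f<g
        , λ j i<j → value-injective (σ j) (f≡g j i<j))

  module Play (E F : Extension) where

    private
      module E = Extension E
      module F = Extension F

    SameLow : ℕ → E.Elem → F.Elem → Set
    SameLow n x y = ∀ c → Low n c → E.val x (E.ι c) ≡ F.val y (F.ι c)

    SameLow-pred : ∀ n {x y} → SameLow (suc n) x y → SameLow n x y
    SameLow-pred n same c l = same c (Low-suc n l)

    module _ (n : ℕ) {x x′ y y′} (same : SameLow (suc n) x y) (same′ : SameLow (suc n) x′ y′)
             (x≈x′ : E.Agree (E.High (suc n)) x x′) (y≈y′ : F.Agree (F.High (suc n)) y y′) where

      -- What `High n` has beyond `High (suc n)` lies in `Low (suc n)`, where `x` equals `y` and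
      -- `x′` equals `y′`.
      Agree-transfer : E.Agree (E.High n) x x′ → F.Agree (F.High n) y y′
      Agree-transfer x≈ = F.agree go
        where
        go : ∀ i → F.High n i → F.val y i ≡ F.val y′ i
        go i h with F.low-or-high (suc n) i
        ... | inj₂ h⁺ = F.agrees y≈y′ i h⁺
        ... | inj₁ (c , l , refl) =
          trans (sym (same c l))
            (trans (E.agrees x≈ (E.ι c) λ c′ l′ → E.ι-mono (F.ι-reflect (h c′ l′))) (same′ c l))

      -- Agreement on `High (suc n)` forces the deciding index into the common part `Low (suc n)`,
      -- so the same coordinate decides in `F`.
      Less-transfer : E.Less (E.High n) x x′ → F.Less (F.High n) y y′
      Less-transfer (E.less i h x<x′ above) with E.low-or-high (suc n) i
      ... | inj₂ h⁺ = ⊥-elim (E.Less⇒¬Agree (E.less i h⁺ x<x′ above) x≈x′)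
      ... | inj₁ (c , l , refl) =
        F.less (F.ι c) (λ c′ l′ → F.ι-mono (E.ι-reflect (h c′ l′)))
          (subst (λ s → orient s _<_ _ _) (trans (E.ι-sign c) (sym (F.ι-sign c)))
            (subst₂ (orient (E.σ (E.ι c)) _<_) (same c l) (same′ c l) x<x′))
          go
        where
        go : ∀ j → F.ι c F.<ᴵ j → F.val y j ≡ F.val y′ j
        go j c<j with F.low-or-high (suc n) j
        ... | inj₂ h⁺ = F.agrees y≈y′ j h⁺
        ... | inj₁ (c′ , l′ , refl) =
          trans (sym (same c′ l′))
            (trans (above (E.ι c′) (E.ι-mono (F.ι-reflect c<j))) (same′ c′ l′))

    -- A strict comparison survives because `High (suc n)` is contained in `High n`. A tie at level
    -- `suc n` is refined by coordinates common to both sides.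
    Alike-pred : ∀ n {x x′ y y′} → SameLow (suc n) x y → SameLow (suc n) x′ y′ →
      Alike (E.Level (suc n)) (F.Level (suc n)) x x′ y y′ → Alike (E.Level n) (F.Level n) x x′ y y′
    Alike-pred n same same′ (both< p q) = both< (E.Less-coarse n p) (F.Less-coarse n q)
    Alike-pred n same same′ (both> p q) = both> (E.Less-coarse n p) (F.Less-coarse n q)
    Alike-pred n {x} {x′} same same′ (both≈ p q)
      with IsStrictTotalOrder.compare (E.Level-isOrder n) x x′
    ... | tri< x<x′ _ _ = both< x<x′ (Less-transfer n same same′ p q x<x′)
    ... | tri≈ _ x≈x′ _ = both≈ x≈x′ (Agree-transfer n same same′ p q x≈x′)
    ... | tri> _ _ x′<x =
      both> x′<x (Less-transfer n same′ same (E.Agree-sym p) (F.Agree-sym q) x′<x)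

    -- Elements assembled from a low and a high part

    relocate : E.Ix → F.Ix
    relocate i with E.split i
    ... | inj₁ (c , _) = F.ι c
    -- A default value: when supports are carried over, only indices in the image of `E.ι` matter.
    ... | inj₂ _       = F.top

    relocate-ι : ∀ c → relocate (E.ι c) ≡ F.ι c
    relocate-ι c with E.split (E.ι c)
    ... | inj₁ (c′ , eq) = cong F.ι (sym (E.ι-injective eq))
    ... | inj₂ above     = ⊥-elim (E.<ᴵ-irrefl refl (above c))

    combine : ℕ → E.Elem → F.Elem → F.Elem
    combine n x b = F.fromVal v (support b ++ map relocate (support x)) v≢0⇒∈
      module Combine where
      v : F.Ix → ℕ
      v i with F.low-or-high n i
      ... | inj₁ (c , _) = E.val x (E.ι c)
      ... | inj₂ _       = F.val b i
      v≢0⇒∈ : ∀ {i} → v i ≢ 0 → i ∈ support b ++ map relocate (support x)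
      v≢0⇒∈ {i} vi≢0 with F.low-or-high n i
      ... | inj₁ (c , _ , refl) = ∈-++⁺ʳ (support b)
              (subst (_∈ _) (relocate-ι c) (∈-map⁺ relocate (E.val-support x vi≢0)))
      ... | inj₂ _ = ∈-++⁺ˡ (F.val-support b vi≢0)

    val-combine : ∀ n x b i → F.val (combine n x b) i ≡ Combine.v n x b i
    val-combine n x b = F.val-fromVal (Combine.v n x b) _ (λ {i} → Combine.v≢0⇒∈ n x b {i})

    combine-low : ∀ n x b → SameLow n x (combine n x b)
    combine-low n x b c l = sym (trans (val-combine n x b (F.ι c)) v≡)
      where
      v≡ : Combine.v n x b (F.ι c) ≡ E.val x (E.ι c)
      v≡ with F.low-or-high n (F.ι c)
      ... | inj₁ (c′ , _ , eq) = cong (E.val x ∘ E.ι) (sym (F.ι-injective eq))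
      ... | inj₂ h             = ⊥-elim (F.¬High-low n l h)

    combine-high : ∀ n x b → F.Agree (F.High n) (combine n x b) b
    combine-high n x b = F.agree λ i h → trans (val-combine n x b i) (v≡ i h)
      where
      v≡ : ∀ i → F.High n i → Combine.v n x b i ≡ F.val b i
      v≡ i h with F.low-or-high n i
      ... | inj₁ (_ , l , refl) = ⊥-elim (F.¬High-low n l h)
      ... | inj₂ _              = refl

    -- The invariant and the answer of player II

    Inv : ∀ n {k} → V.Vector E.Elem k → V.Vector F.Elem k → Set
    Inv n a b = (∀ i j → Alike (E.Level n) (F.Level n) (a i) (a j) (b i) (b j))
              × (∀ i → SameLow n (a i) (b i))

    Inv-extend : ∀ n {k} {a : V.Vector E.Elem k} {b : V.Vector F.Elem k} {x y} →
      Inv (suc n) a b → SameLow n x y →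
      (∀ j → Alike (E.Level n) (F.Level n) x (a j) y (b j)) → Inv n (x V.∷ a) (y V.∷ b)
    Inv-extend n {a = a} {b} {x} {y} (alike , same) same-x alike-x = alike′ , same′
      where
      alike′ : ∀ i j → Alike (E.Level n) (F.Level n)
        ((x V.∷ a) i) ((x V.∷ a) j) ((y V.∷ b) i) ((y V.∷ b) j)
      alike′ zero    zero    = both≈ E.Agree-refl F.Agree-refl
      alike′ zero    (suc j) = alike-x j
      alike′ (suc i) zero    = Alike-flip (E.Level-isOrder n) (F.Level-isOrder n) (alike-x i)
      alike′ (suc i) (suc j) = Alike-pred n (same i) (same j) (alike i j)
      same′ : ∀ i → SameLow n ((x V.∷ a) i) ((y V.∷ b) i)
      same′ zero    = same-x
      same′ (suc i) = SameLow-pred n {a i} {b i} (same i)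

    respond : ∀ n {k} {a : V.Vector E.Elem k} {b : V.Vector F.Elem k} → Inv (suc n) a b →
      ∀ x → ∃ λ y → Inv n (x V.∷ a) (y V.∷ b)
    respond n {k} {a} {b} inv@(alike , same) x
      with Finₚ.any? (λ i → IsStrictTotalOrder._≟_ (E.Level-isOrder (suc n)) (a i) x)
    -- Combining at level `suc n`, not `n`, keeps `y` equal to `b i` on all of `High (suc n)`. So
    -- `x` and `y` inherit the comparisons of `a i` and `b i`, which `Alike-pred` refines.
    ... | yes (i , ai≈x) = y , Inv-extend n inv (SameLow-pred n {x} {y} same-x) λ j →
            Alike-pred n same-x (same j)
              (Alike-respˡ (E.Level-isOrder (suc n)) (F.Level-isOrder (suc n)) ai≈x
                (F.Agree-sym (combine-high (suc n) x (b i))) (alike i j))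
      where
      y = combine (suc n) x (b i)
      same-x = combine-low (suc n) x (b i)
    ... | no x-new = answer
      where
      module E⁺ = IsStrictTotalOrder (E.oriented-isOrder (suc n))
      module F⁺ = IsStrictTotalOrder (F.oriented-isOrder (suc n))
      module Fₙ = IsStrictTotalOrder (F.oriented-isOrder n)

      _E<_ = orient d (E.Less (E.High (suc n)))
      _F<_ = orient d (F.Less (F.High (suc n)))
      _F<ₙ_ = orient d (F.Less (F.High n))

      E-coarse : ∀ {f g} → f E< g → orient d (E.Less (E.High n)) f g
      E-coarse = orient-map d (E.Less-coarse n)
      F-coarse : ∀ {f g} → f F< g → f F<ₙ g
      F-coarse = orient-map d (F.Less-coarse n)

      -- As `x` is new, every `a j` lies strictly on one side of it at level `suc n`; it remains to
      -- put `y` on the same side of `b j` at the finer level `n`.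
      fits : ∀ y → (∀ j → a j E< x → b j F<ₙ y) → (∀ j → x E< a j → y F<ₙ b j) →
        ∀ j → Alike (E.Level n) (F.Level n) x (a j) y (b j)
      fits y below above j with E⁺.compare (a j) x
      ... | tri< aj<x _ _ = Alike-unorient d (both> (E-coarse aj<x) (below j aj<x))
      ... | tri≈ _ aj≈x _ = ⊥-elim (x-new (j , aj≈x))
      ... | tri> _ _ x<aj = Alike-unorient d (both< (E-coarse x<aj) (above j x<aj))

      -- Take a `b p` that is least in direction `d` and increment it at `top`, whose factor runs
      -- the other way.
      lower-bound : ∃ λ z → ∀ j → z F< b j
      lower-bound
        with greatest (Flip.isStrictTotalOrder (F.oriented-isOrder (suc n))) b (λ _ → yes tt) (allFin k)
      -- Here `k` is zero, so any element will do.
      ... | inj₁ none = F.fromVal (const 0) [] (λ 0≢0 → ⊥-elim (0≢0 refl))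
                      , λ j → ⊥-elim (none (∈-allFin j) tt)
      ... | inj₂ (p , _ , min) = F.bump F.top (b p) , λ j → lower j (F⁺.compare (b p) (b j))
        where
        bump<p : F.bump F.top (b p) F< b p
        bump<p = orient-opposite F.top-sign
                   (F.Less-bump F.top (b p) (F.σ F.top) refl λ c _ → F.top-above c)
        lower : ∀ j → Tri (b p F< b j) _ (b j F< b p) → F.bump F.top (b p) F< b j
        lower j (tri< p<j _ _) = F⁺.trans bump<p p<j
        lower j (tri≈ _ p≈j _) = F⁺.<-respʳ-≈ p≈j bump<p
        lower j (tri> _ _ j<p) = ⊥-elim (min (∈-allFin j) tt j<p)

      answer : ∃ λ y → Inv n (x V.∷ a) (y V.∷ b)
      answer
        -- The maximum is taken at level `n`: points `b j` that agree on `High (suc n)` may differ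
        -- on `High n`, and `y` has to pass them all.
        with greatest (F.oriented-isOrder n) b (λ j → a j E⁺.<? x) (allFin k)
      ... | inj₁ none = y , Inv-extend n inv (combine-low n x z) (fits y
              (λ j aj<x → ⊥-elim (none (∈-allFin j) aj<x))
              (λ j _ → Fₙ.<-respˡ-≈ (F.Agree-sym (combine-high n x z)) (F-coarse (z< j))))
        where
        z = proj₁ lower-bound
        z< = proj₂ lower-bound
        y = combine n x z
      ... | inj₂ (p , ap<x , max) = y , Inv-extend n inv (combine-low n x z) (fits y below above)
        where
        -- This coordinate is in `High n` but not in `High (suc n)`: incrementing it moves past
        -- `b p` at level `n` and is invisible at level `suc n`.
        i₀ = F.ι (e n)
        z = F.bump i₀ (b p)
        y = combine n x z
        bp<y : b p F<ₙ y
        bp<y = Fₙ.<-respʳ-≈ (F.Agree-sym (combine-high n x z))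
                 (F.Less-bump i₀ (b p) d (trans (F.ι-sign (e n)) (e-sign n)) (F.High-e n))
        bp≈y : F.Agree (F.High (suc n)) (b p) y
        bp≈y = F⁺.Eq.sym (F.Agree-trans
                 (F.agree λ i h → F.agrees (combine-high n x z) i (F.High-suc n h))
                 (F.Agree-bump i₀ (b p) (F.¬High-low (suc n) (e-mono n))))
        below : ∀ j → a j E< x → b j F<ₙ y
        below j aj<x with Fₙ.compare (b j) (b p)
        ... | tri< bj<bp _ _ = Fₙ.trans bj<bp bp<y
        ... | tri≈ _ bj≈bp _ = Fₙ.<-respˡ-≈ (Fₙ.Eq.sym bj≈bp) bp<y
        ... | tri> _ _ bp<bj = ⊥-elim (max (∈-allFin j) aj<x bp<bj)
        above : ∀ j → x E< a j → y F<ₙ b j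
        -- From `a p` before `x` before `a j` the invariant puts `b p` before `b j` at level
        -- `suc n`, where `y` cannot be told from `b p`.
        above j x<aj = F-coarse (F⁺.<-respˡ-≈ bp≈y
          (Alike⇒< (E.oriented-isOrder (suc n)) (F.oriented-isOrder (suc n))
            (Alike-orient d (alike p j)) (E⁺.trans ap<x x<aj)))

  Inv-swap : ∀ E F n {k} {a : V.Vector (Extension.Elem E) k} {b : V.Vector (Extension.Elem F) k} →
    Play.Inv E F n a b → Play.Inv F E n b a
  Inv-swap E F n (alike , same) = (λ i j → Alike-swap (alike i j)) , λ i c l → sym (same i c l)

  -- Each round costs one level, and at level 0 every coordinate counts, so the invariant gives a
  -- partial isomorphism. Moves of I in `F` are answered with the two sides exchanged.
  Inv⇒IIWins : ∀ E F n {k} {a : V.Vector (Extension.Elem E) k} {b : V.Vector (Extension.Elem F) k} →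
    Play.Inv E F n a b → IIWins (Extension.structure E) (Extension.structure F) n a b
  Inv⇒IIWins E F zero (alike , _) i j =
    ((⇔-sym F.Agree⇔≈ ⇔-∘ Alike⇒≈⇔ (E.Level-isOrder 0) (F.Level-isOrder 0) (alike i j)) ⇔-∘ E.Agree⇔≈) ,
    ((⇔-sym F.Less⇔< ⇔-∘ Alike⇒<⇔ (E.Level-isOrder 0) (F.Level-isOrder 0) (alike i j)) ⇔-∘ E.Less⇔<)
    where
    module E = Extension E
    module F = Extension F
  Inv⇒IIWins E F (suc n) inv =
    (λ x → let y , inv′ = Play.respond E F n inv x in y , Inv⇒IIWins E F n inv′) ,
    (λ y → let x , inv′ = Play.respond F E n (Inv-swap E F (suc n) inv) y
           in x , Inv⇒IIWins E F n (Inv-swap F E n inv′))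

  extensions-≡[] : ∀ E F k → Extension.structure E ≡[ k ] Extension.structure F
  extensions-≡[] E F k = Inv⇒IIWins E F k ((λ ()) , (λ ()))

-- Positions in monomials

blk-injective : ∀ L {b b′ : Block L} → blk {L} b ≡ blk {L} b′ → b ≡ b′
blk-injective (fin L) = Finₚ.toℕ-injective
blk-injective inf     = id

blockAt : ∀ L j → suc j ≤ᴸ L → ∃ λ (b : Block L) → blk {L} b ≡ j
blockAt (fin L) j j<L = fromℕ< j<L , Finₚ.toℕ-fromℕ< j<L
blockAt inf     j _   = j , refl

≤ᴸ-trans : ∀ L {j k} → j ≤ k → k ≤ᴸ L → j ≤ᴸ L
≤ᴸ-trans (fin L) = ≤-trans
≤ᴸ-trans inf _ _ = tt

module _ (Λ : WellOrder) where

  PosLt-isStrictTotalOrder : ∀ t m j → IsStrictTotalOrder _≡_ (PosLt t m Λ j)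
  PosLt-isStrictTotalOrder zero    m zero    = isSTO Λ
  PosLt-isStrictTotalOrder zero    m (suc j) = Finₚ.<-isStrictTotalOrder
  PosLt-isStrictTotalOrder (suc t) m zero    = Finₚ.<-isStrictTotalOrder
  PosLt-isStrictTotalOrder (suc t) m (suc j) = PosLt-isStrictTotalOrder t (m ∘ suc) j

  module _ (t : ℕ) (m : ℕ → ℕ) (L : Length) where

    private
      module Posₚ j = IsStrictTotalOrder (PosLt-isStrictTotalOrder t m j)

    IdxLt-trans : Transitive (IdxLt {t} {m} {Λ} {L})
    IdxLt-trans (blk< p) (blk< q) = blk< (<-trans p q)
    IdxLt-trans (blk< p) (pos< q) = blk< p
    IdxLt-trans (pos< p) (blk< q) = blk< q
    IdxLt-trans (pos< p) (pos< q) = pos< (Posₚ.trans _ p q)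

    IdxLt-irrefl : ∀ {i : Idx t m Λ L} → ¬ IdxLt i i
    IdxLt-irrefl (blk< p) = <-irrefl refl p
    IdxLt-irrefl (pos< p) = Posₚ.irrefl _ refl p

    IdxLt-compare : Trichotomous _≡_ (IdxLt {t} {m} {Λ} {L})
    IdxLt-compare i j = tri (weak i j)
      where
      weak : (i j : Idx t m Λ L) → IdxLt i j ⊎ i ≡ j ⊎ IdxLt j i
      weak (idx b p) (idx b′ p′) with <-cmp (blk {L} b) (blk {L} b′)
      ... | tri< b<b′ _ _ = inj₁ (blk< b<b′)
      ... | tri> _ _ b′<b = inj₂ (inj₂ (blk< b′<b))
      ... | tri≈ _ b≡b′ _ with blk-injective L {b} {b′} b≡b′
      ...   | refl with Posₚ.compare (blk {L} b) p p′
      ...     | tri< p<p′ _ _ = inj₁ (pos< p<p′)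
      ...     | tri≈ _ refl _ = inj₂ (inj₁ refl)
      ...     | tri> _ _ p′<p = inj₂ (inj₂ (pos< p′<p))
      asym : ∀ {i j : Idx t m Λ L} → IdxLt i j → ¬ IdxLt j i
      asym i<j j<i = IdxLt-irrefl (IdxLt-trans i<j j<i)
      tri : ∀ {i j : Idx t m Λ L} → IdxLt i j ⊎ i ≡ j ⊎ IdxLt j i → Tri (IdxLt i j) (i ≡ j) (IdxLt j i)
      tri (inj₁ i<j)         = tri< i<j (λ { refl → IdxLt-irrefl i<j }) (asym i<j)
      tri (inj₂ (inj₁ refl)) = tri≈ IdxLt-irrefl refl IdxLt-irrefl
      tri (inj₂ (inj₂ j<i))  = tri> (asym j<i) (λ { refl → IdxLt-irrefl j<i }) j<i

    IdxLt-isStrictTotalOrder : IsStrictTotalOrder _≡_ (IdxLt {t} {m} {Λ} {L})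
    IdxLt-isStrictTotalOrder = isStrictTotalOrderᶜ record
      { isEquivalence = isEquivalence ; trans = IdxLt-trans ; compare = IdxLt-compare }

  -- Positions and their order are bundled so that a single equation transports both.
  PosOrder : (t : ℕ) (m : ℕ → ℕ) (j : ℕ) → Σ Set λ A → A → A → Set
  PosOrder t m j = Pos t m Λ j , PosLt t m Λ j

  -- Up to block `t` only the exponents before `t` enter, since block `t` itself has exponent `Λ`.
  PosOrder-cong : ∀ t {m m′ : ℕ → ℕ} → (∀ i → i < t → m i ≡ m′ i) →
    ∀ {j} → j ≤ t → PosOrder t m j ≡ PosOrder t m′ j
  PosOrder-cong zero    m≡m′ z≤n = refl
  PosOrder-cong (suc t) m≡m′ {zero}  _ = cong (λ k → Fin k , λ p q → toℕ p < toℕ q) (m≡m′ 0 z<s)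
  PosOrder-cong (suc t) m≡m′ {suc j} (s≤s j≤t) = PosOrder-cong t (λ i i<t → m≡m′ (suc i) (s≤s i<t)) j≤t

  -- `toℕ (fromℕ t)` is not `t` by computation for variable `t`; recursion on `t` avoids a
  -- transport.
  exponentPos : ∀ t m → Elt Λ → Pos t m Λ (toℕ (fromℕ t))
  exponentPos zero    m = id
  exponentPos (suc t) m = exponentPos t (m ∘ suc)

  exponentPos-mono : ∀ t m {x y} → _<ʷ_ Λ x y →
    PosLt t m Λ (toℕ (fromℕ t)) (exponentPos t m x) (exponentPos t m y)
  exponentPos-mono zero    m x<y = x<y
  exponentPos-mono (suc t) m x<y = exponentPos-mono t (m ∘ suc) x<y

  posAfter : ∀ t m → 0 < m (suc t) → Pos t m Λ (suc t)
  posAfter zero    m 0<m = fromℕ< 0<m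
  posAfter (suc t) m = posAfter t (m ∘ suc)

transport : {P Q : Σ Set λ A → A → A → Set} → P ≡ Q → proj₁ P → proj₁ Q
transport = subst proj₁

transport-mono : {P Q : Σ Set λ A → A → A → Set} (q : P ≡ Q) {x y : proj₁ P} →
  proj₂ P x y → proj₂ Q (transport q x) (transport q y)
transport-mono refl x<y = x<y

-- All monomials sharing the blocks up to t extend the monomial consisting of these blocks.

module _ (M : ℕ → Base) (alternates : ∀ i → M (suc i) ≢ M i) (t : ℕ) (m : ℕ → ℕ)
         (Λ : WellOrder) (e : ω≤ Λ) where

  private
    Core : Set
    Core = Idx t m Λ (fin (suc t))

    module G = Game {Core} (IdxLt-isStrictTotalOrder Λ t m (fin (suc t)))
      (λ c → M (toℕ (block c))) (M t)
      (λ n → idx (fromℕ t) (exponentPos Λ t m (proj₁ e n)))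
      (λ n → pos< (exponentPos-mono Λ t m (proj₂ e (n<1+n n))))
      (λ n → cong M (Finₚ.toℕ-fromℕ t))

  monomialExtension : ∀ m′ → (∀ i → i < t → m i ≡ m′ i) → 0 < m′ (suc t) →
    ∀ L → suc (suc t) ≤ᴸ L → G.Extension
  monomialExtension m′ m≡m′ 0<m′ L t+1<L = record
    { Ix        = Idx t m′ Λ L
    ; _<ᴵ_      = IdxLt
    ; isSTOᴵ    = IdxLt-isStrictTotalOrder Λ t m′ L
    ; σ         = λ i → M (blk {L} (block i))
    ; ι         = ι
    ; ι-mono    = ι-mono
    ; ι-sign    = λ c → cong M (proj₂ (place c))
    ; split     = split
    ; top       = idx (proj₁ topBlock) (transport (cong (PosOrder Λ t m′) (sym (proj₂ topBlock)))
                                                  (posAfter Λ t m′ 0<m′))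
    ; top-above = λ c → blk< (subst₂ _<_ (sym (proj₂ (place c))) (sym (proj₂ topBlock))
                                (Finₚ.toℕ<n (block c)))
    ; top-sign  = λ eq → alternates t (trans (sym (cong M (proj₂ topBlock))) eq)
    }
    where
    topBlock : ∃ λ (b : Block L) → blk {L} b ≡ suc t
    topBlock = blockAt L (suc t) t+1<L

    place : (c : Core) → ∃ λ (b : Block L) → blk {L} b ≡ toℕ (block c)
    place c = blockAt L (toℕ (block c)) (≤ᴸ-trans L (<⇒≤ (s≤s (Finₚ.toℕ<n (block c)))) t+1<L)

    relabel : ∀ {j j′} → j ≤ t → j′ ≡ j → PosOrder Λ t m j ≡ PosOrder Λ t m′ j′
    relabel j≤t j′≡j = trans (PosOrder-cong Λ t m≡m′ j≤t) (cong (PosOrder Λ t m′) (sym j′≡j))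

    ι : Core → Idx t m′ Λ L
    ι c@(idx b p) = idx (proj₁ (place c))
      (transport (relabel (≤-pred (Finₚ.toℕ<n b)) (proj₂ (place c))) p)

    ι-mono : ∀ {c c′} → IdxLt c c′ → IdxLt (ι c) (ι c′)
    ι-mono {c} {c′} (blk< b<b′) = blk< (subst₂ _<_ (sym (proj₂ (place c))) (sym (proj₂ (place c′))) b<b′)
    ι-mono (pos< p<p′) = pos< (transport-mono (relabel _ _) p<p′)

    -- Uniqueness of identity proofs makes the choice of q irrelevant.
    idx-transport : ∀ {b b′} → blk {L} b ≡ blk {L} b′ →
      (q : PosOrder Λ t m′ (blk {L} b) ≡ PosOrder Λ t m′ (blk {L} b′)) → ∀ p →
      idx {t} {m′} {Λ} {L} b p ≡ idx b′ (transport q p)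
    idx-transport {b} {b′} b≡b′ q p with blk-injective L {b} {b′} b≡b′
    idx-transport b≡b′ refl p | refl = refl

    split : ∀ i → (∃ λ c → i ≡ ι c) ⊎ (∀ c → IdxLt (ι c) i)
    split (idx b p) with blk {L} b <? suc t
    ... | no b≮ = inj₂ λ c → blk< (subst (_< blk {L} b) (sym (proj₂ (place c)))
                                    (<-≤-trans (Finₚ.toℕ<n (block c)) (≮⇒≥ b≮)))
    -- The preimage is `i` carried back into the core; `ι` carries it forward again, and the
    -- composite transport is absorbed by `idx-transport`.
    ... | yes b< = inj₁ (c , trans (idx-transport b≡ (trans back forth) p) (cong (idx _) transports))
      where
      back : PosOrder Λ t m′ (blk {L} b) ≡ PosOrder Λ t m (toℕ (fromℕ< b<))
      back = sym (relabel (≤-pred (Finₚ.toℕ<n (fromℕ< b<))) (sym (Finₚ.toℕ-fromℕ< b<)))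
      c : Core
      c = idx (fromℕ< b<) (transport back p)
      b≡ : blk {L} b ≡ blk {L} (proj₁ (place c))
      b≡ = trans (sym (Finₚ.toℕ-fromℕ< b<)) (sym (proj₂ (place c)))
      forth = relabel (≤-pred (Finₚ.toℕ<n (fromℕ< b<))) (proj₂ (place c))
      transports : transport (trans back forth) p ≡ transport forth (transport back p)
      transports = sym (subst-subst back)

  monomials-≡[] : ∀ m₁ m₂ → (∀ i → i < t → m i ≡ m₁ i) → (∀ i → i < t → m i ≡ m₂ i) →
    0 < m₁ (suc t) → 0 < m₂ (suc t) → ∀ L₁ L₂ → suc (suc t) ≤ᴸ L₁ → suc (suc t) ≤ᴸ L₂ →
    ∀ k → Monomial M t m₁ Λ L₁ ≡[ k ] Monomial M t m₂ Λ L₂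
  monomials-≡[] m₁ m₂ m≡m₁ m≡m₂ 0<m₁ 0<m₂ L₁ L₂ t<L₁ t<L₂ =
    G.extensions-≡[] (monomialExtension m₁ m≡m₁ 0<m₁ L₁ t<L₁) (monomialExtension m₂ m≡m₂ 0<m₂ L₂ t<L₂)

-- Changing one exponent, and the theorem

≔-same : ∀ m k n → (m [ k ≔ n ]) k ≡ n
≔-same m k n with k ≟ k
... | yes _  = refl
... | no k≢k = ⊥-elim (k≢k refl)

≔-other : ∀ m k n {j} → j ≢ k → (m [ k ≔ n ]) j ≡ m j
≔-other m k n {j} j≢k with j ≟ k
... | yes j≡k = ⊥-elim (j≢k j≡k)
... | no _    = refl

theorem3p9 : (M : ℕ → Base) → (∀ i → M (suc i) ≢ M i)
    → (t : ℕ) (m : ℕ → ℕ) → (∀ i → i ≢ t → 0 < m i)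
    → (Λ : WellOrder) → ω≤ Λ
    → (n : ℕ) → 0 < n
    → (L : Length) → suc (suc (suc t)) ≤ᴸ L
    → ((k : ℕ) → Monomial M t m Λ L ≡[ k ] Monomial M t (m [ suc t ≔ n ]) Λ (fin (suc (suc t))))
    × (Monomial M t m Λ L ≡ᴱ Monomial M t (m [ suc t ≔ n ]) Λ (fin (suc (suc t))))
theorem3p9 M alternates t m 0<m Λ e n 0<n L t+2<L = A≡[k]B , ≡[]⇒≡ᴱ A≡[k]B
  where
  A≡[k]B : (k : ℕ) → Monomial M t m Λ L ≡[ k ] Monomial M t (m [ suc t ≔ n ]) Λ (fin (suc (suc t)))
  A≡[k]B = monomials-≡[] M alternates t m Λ e m (m [ suc t ≔ n ])
    (λ _ _ → refl)
    (λ i i<t → sym (≔-other m (suc t) n (<⇒≢ (<-trans i<t (n<1+n t)))))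
    (0<m (suc t) (<⇒≢ (n<1+n t) ∘ sym))
    (subst (0 <_) (sym (≔-same m (suc t) n)) 0<n)
    -- Having a block `suc t` means having length at least `suc (suc t)`, which the second monomial
    -- attains exactly.
    L (fin (suc (suc t))) (≤ᴸ-trans L (<⇒≤ (n<1+n _)) t+2<L) ≤-refl
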